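{- Let $A$ be a set of actions. Every formal equation $e=f$ between star expressions over $A$ that is derivable in $\mathsf{Mil}$ is also derivable in $\mathsf{cMil}_1$. Moreover, every derivation in $\mathsf{Mil}$ with conclusion $e=f$ can be transformed effectively into a derivation in $\mathsf{cMil}_1$ with conclusion $e=f$.
   Context: **Star expressions and equational systems.** Star expressions over $A$, forming the set $StExp(A)$, are given by $e ::= 0 \mid 1 \mid a \mid (e_1+e_2)\mid (e_1\cdot e_2)\mid (e^*)$ with $a\in A$. $\equiv$ is syntactic equality. $Eq(A)$ is the set of formal equations $e=f$ with $e,f\in StExp(A)$. Immediate termination $e{\downarrow}$ is defined inductively: $1{\downarrow}$; $(e_1+e_2){\downarrow}$ if $e_1{\downarrow}$ or $e_2{\downarrow}$; $(e_1\cdot e_2){\downarrow}$ if $e_1{\downarrow}$ and $e_2{\downarrow}$; $(e^*){\downarrow}$ always. Finite sums $\sum_{i=1}^n e_i$ denote $0$ if $n=0$, $e_1$ if $n=1$, and $(\sum_{i=1}^{n-1}e_i)+e_n$ if $n>1$. An $\mathcal{EL}$-based system over $StExp(A)$ is a proof system whose formulas are the equations in $Eq(A)$ and whose rules include those of equational logic (reflexivity, symmetry, transitivity, closure under one-hole star expression contexts); it may have further axioms and rules. $e=_{\mathcal S}f$ means that $e=f$ is derivable in $\mathcal S$ without assumptions. $\mathsf{Mil}^-$ is the $\mathcal{EL}$-based system with only the rules of equational logic and the axiom schemes: $(e+f)+g=e+(f+g)$; $e+0=e$; $e+f=f+e$; $e+e=e$; $(e\cdot f)\cdot g=e\cdot(f\cdot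 g)$; $(e+f)\cdot g=e\cdot g+f\cdot g$; $1\cdot e=e$; $e\cdot 1=e$; $0\cdot e=0$; $e^*=1+e\cdot e^*$; $e^*=(1+e)^*$. For $\Gamma\subseteq Eq(A)$, $\mathsf{Mil}^-+\Gamma$ is $\mathsf{Mil}^-$ with the equations in $\Gamma$ added as axioms. Milner's system $\mathsf{Mil}$ is $\mathsf{Mil}^-$ plus the rule $\mathrm{RSP}^*$: from $e=f\cdot e+g$ infer $e=f^*\cdot g$, provided that $f{\downarrow}$ does not hold. **1-charts and LLEE.** A 1-chart is a tuple $\underline{C}=\langle V,A,1,v_s,\to,{\downarrow}\rangle$ with $V$ a finite set of vertices, $1\notin A$ the empty-step label, $v_s\in V$ the start vertex, ${\to}\subseteq V\times(A\cup\{1\})\times V$ a (finite) labeled transition relation, and ${\downarrow}\subseteq V$ the set of vertices with immediate termination. Transitions labeled in $A$ are proper; those labeled $1$ are 1-transitions. It is weakly guarded if it has no cycle of 1-transitions. A loop 1-chart is a 1-chart such that (L1) there is an infinite path from its start vertex, (L2) every infinite path from the start vertex returns to it after a positive number of transitions, (L3) only the start vertex may have immediate termination. For a vertex $v$ of $\underline C$ and a nonempty set $U$ of transitions from $v$, consider the sub-1-chart with start vertex $v$ consisting of all vertices and transitions on paths that start with a transition in $U$ and continue until $v$ is reached again (termination inherited from $\underline C$). If it is a loop 1-chart it is called a loop sub-1-chart of $\underline C$, with loop-entry transitions $U$; its remaining transitions are its loop-body transitions. Eliminating it from $\underline C$ means removing the transitions in $U$ and then all vertices and transitions that become unreachable from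 the start vertex. $\underline C$ is an LLEE-1-chart if there is a finite sequence $\underline C=\underline C_0,\dots,\underline C_n$ where $\underline C_i$ results from $\underline C_{i-1}$ by eliminating a loop sub-1-chart $L_i$ of $\underline{C}_{i-1}$ with loop-entry transitions $U_i$, $\underline C_n$ has no infinite path, and for $i<j$ no transition in $U_j$ is a loop-body transition of $L_i$ (layeredness). **Coinductive proofs.** Let $\mathcal S$ be an $\mathcal{EL}$-based system containing the axioms for associativity, commutativity and idempotency of $+$. A function $s:V\to StExp(A)$ is an $\mathcal S$-provable solution of $\underline C$ if for every $v\in V$, with $\{v\xrightarrow{\underline a_i}v_i\mid 1\le i\le n\}$ a list of all transitions from $v$, it holds that $s(v)=_{\mathcal S}\tau(v)+\sum_{i=1}^n\underline a_i\cdot s(v_i)$, where $\tau(v)\equiv 1$ if $v\in{\downarrow}$ and $\tau(v)\equiv 0$ otherwise (the label $1$ being read as the star expression $1$). A coinductive proof over $\mathcal S$ of $e_1=e_2$ is a pair $\langle\underline C,L\rangle$ with $\underline C$ a weakly guarded 1-chart and $L:V\to Eq(A)$, $L(v)=(L_1(v)=L_2(v))$, such that $L_1$ and $L_2$ are $\mathcal S$-provable solutions of $\underline C$, and $e_1\equiv L_1(v_s)$, $e_2\equiv L_2(v_s)$. It is LLEE-witnessed if $\underline C$ is an LLEE-1-chart. **The system $\mathsf{cMil}_1$.** The rule $\mathrm{LCoProof}_1$ has as premises an equation $g=h$ and an LLEE-witnessed coinductive proof of $e=f$ over $\mathsf{Mil}^-+\{g=h\}$, and has conclusion $e=f$. (The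 coinductive-proof premise is a given object that needs no further derivation.) $\mathsf{cMil}_1$ has the axioms of $\mathsf{Mil}^-$, the rules of equational logic, and the rule $\mathrm{LCoProof}_1$. -}

module Defs where

open import Level using (Level; 0ℓ; _⊔_) renaming (suc to lsuc)
open import Data.Bool using (Bool; T; if_then_else_)
open import Data.Empty using (⊥)
open import Data.Fin using (Fin)
open import Data.List using (List; []; _∷_; map; foldl)
open import Data.List.Membership.Propositional using (_∈_)
open import Data.Maybe using (Maybe; just; nothing)
open import Data.Nat using (ℕ; suc)
open import Data.Product using (∃-syntax; Σ-syntax; _×_; _,_; proj₁)
open import Data.Unit using (⊤; tt)
open import Function using (_∘_)
open import Function.Bundles using (_↔_)
open import Relation.Binary using (Rel)
open import Relation.Binary.Construct.Closure.ReflexiveTransitive using (Star; ε; _◅_; _◅◅_)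
open import Relation.Binary.Construct.Closure.Transitive using (TransClosure)
open import Relation.Binary.PropositionalEquality using (_≡_; _≢_)
open import Relation.Nullary using (¬_)
open import Relation.Unary using (Pred; _∪_; ｛_｝; Satisfiable)

infixr 8 _·_
infixl 7 _+_
infix  9 _*
infix  4 _≐_
infix  4 _↓
infix  3 _⊢_

data StExp (A : Set) : Set where
  𝟎 𝟏 : StExp A
  act : A → StExp A
  _+_ : StExp A → StExp A → StExp A
  _·_ : StExp A → StExp A → StExp A
  _*  : StExp A → StExp A

record Equation (A : Set) : Set where
  constructor _≐_
  field
    lhs rhs : StExp A

open Equation public

data _↓ {A : Set} : StExp A → Set where
  𝟏↓  : 𝟏 ↓
  +↓ₗ : ∀ {e f} → e ↓ → e + f ↓
  +↓ᵣ : ∀ {e f} → f ↓ → e + f ↓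
  ·↓  : ∀ {e f} → e ↓ → f ↓ → e · f ↓
  *↓  : ∀ {e} → e * ↓

-- Left-nested: ∑ (e₁ ∷ e₂ ∷ e₃ ∷ []) is (e₁ + e₂) + e₃, without a summand 𝟎.
∑ : {A : Set} → List (StExp A) → StExp A
∑ []       = 𝟎
∑ (e ∷ es) = foldl _+_ e es

data Context (A : Set) : Set where
  □    : Context A
  _+ˡ_ : Context A → StExp A → Context A
  _+ʳ_ : StExp A → Context A → Context A
  _·ˡ_ : Context A → StExp A → Context A
  _·ʳ_ : StExp A → Context A → Context A
  _*ᶜ  : Context A → Context A

_[_] : {A : Set} → Context A → StExp A → StExp A
□        [ e ] = e
(C +ˡ f) [ e ] = C [ e ] + f
(f +ʳ C) [ e ] = f + C [ e ]
(C ·ˡ f) [ e ] = C [ e ] · f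
(f ·ʳ C) [ e ] = f · C [ e ]
(C *ᶜ)   [ e ] = (C [ e ]) *

-- An EL-based system is given by what it has in addition to equational logic:
-- its axioms and its rules.  Rules with a single derivable premise are enough
-- here; Rule E E′ is the type of instances with premise E and conclusion E′,
-- including their side conditions and any objects attached to them.
record System (A : Set) (a r : Level) : Set (lsuc (a ⊔ r)) where
  field
    Axiom : Pred (Equation A) a
    Rule  : Equation A → Equation A → Set r

-- Derivations without assumptions, as proof-relevant trees.
data _⊢_ {A : Set} {a r : Level} (S : System A a r) : Equation A → Set (a ⊔ r) where
  axiom   : ∀ {E} → System.Axiom S E → S ⊢ E
  reflₑ   : ∀ {e} → S ⊢ e ≐ e
  symₑ    : ∀ {e f} → S ⊢ e ≐ f → S ⊢ f ≐ e
  transₑ  : ∀ {e f g} → S ⊢ e ≐ f → S ⊢ f ≐ g → S ⊢ e ≐ g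
  context : ∀ {e f} (C : Context A) → S ⊢ e ≐ f → S ⊢ C [ e ] ≐ C [ f ]
  rule    : ∀ {E E′} → System.Rule S E E′ → S ⊢ E → S ⊢ E′

data Mil⁻Axiom {A : Set} : Pred (Equation A) 0ℓ where
  +-assoc   : ∀ {e f g} → Mil⁻Axiom ((e + f) + g ≐ e + (f + g))
  +-neutral : ∀ {e} → Mil⁻Axiom (e + 𝟎 ≐ e)
  +-comm    : ∀ {e f} → Mil⁻Axiom (e + f ≐ f + e)
  +-idem    : ∀ {e} → Mil⁻Axiom (e + e ≐ e)
  ·-assoc   : ∀ {e f g} → Mil⁻Axiom ((e · f) · g ≐ e · (f · g))
  ·-distribʳ : ∀ {e f g} → Mil⁻Axiom ((e + f) · g ≐ e · g + f · g)
  ·-idˡ     : ∀ {e} → Mil⁻Axiom (𝟏 · e ≐ e)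
  ·-idʳ     : ∀ {e} → Mil⁻Axiom (e · 𝟏 ≐ e)
  ·-zeroˡ   : ∀ {e} → Mil⁻Axiom (𝟎 · e ≐ 𝟎)
  *-unfold  : ∀ {e} → Mil⁻Axiom (e * ≐ 𝟏 + e · e *)
  *-term    : ∀ {e} → Mil⁻Axiom (e * ≐ (𝟏 + e) *)

Mil⁻+ : {A : Set} → Pred (Equation A) 0ℓ → System A 0ℓ 0ℓ
Mil⁻+ Γ = record { Axiom = Mil⁻Axiom ∪ Γ ; Rule = λ _ _ → ⊥ }

data RSP* {A : Set} : Equation A → Equation A → Set where
  rsp* : ∀ {e f g} → ¬ (f ↓) → RSP* (e ≐ f · e + g) (e ≐ f * · g)

Mil : (A : Set) → System A 0ℓ 0ℓ
Mil A = record { Axiom = Mil⁻Axiom ; Rule = RSP* }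

-- The label nothing is the empty-step label 1.  The transition relation is
-- v —[ α ]→ w iff (α , w) ∈ out v, so out v is a list of all transitions from
-- v; order and repetitions in it are immaterial in the presence of
-- associativity, commutativity and idempotency of +.
record OneChart (A : Set) : Set₁ where
  field
    V          : Set
    size       : ℕ
    finite     : V ↔ Fin size
    start      : V
    out        : V → List (Maybe A × V)
    terminates : V → Bool

  Transition : Set
  Transition = V × Maybe A × V

  OneStep : Rel V 0ℓ
  OneStep v w = (nothing , w) ∈ out v

  WeaklyGuarded : Set
  WeaklyGuarded = ∀ v → ¬ TransClosure OneStep v v

-- The charts met during loop elimination, and their loop sub-1-charts, all live
-- on the vertices of one ambient 1-chart, with termination inherited from it.
record SubChart {A : Set} (C : OneChart A) : Set₁ where
  open OneChart C
  field
    root    : V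
    Vertex  : Pred V 0ℓ
    Trans   : Pred Transition 0ℓ
    root∈   : Vertex root
    source∈ : ∀ {v α w} → Trans (v , α , w) → Vertex v
    target∈ : ∀ {v α w} → Trans (v , α , w) → Vertex w
    Trans⊆  : ∀ {v α w} → Trans (v , α , w) → (α , w) ∈ out v

  InfinitePath : (ℕ → V) → Set
  InfinitePath p = ∀ i → ∃[ α ] Trans (p i , α , p (suc i))

  record IsLoop : Set where
    field
      L1 : ∃[ p ] (InfinitePath p × p 0 ≡ root)
      L2 : ∀ p → InfinitePath p → p 0 ≡ root → ∃[ n ] p (suc n) ≡ root
      L3 : ∀ v → Vertex v → T (terminates v) → v ≡ root

module _ {A : Set} {C : OneChart A} where
  open OneChart C

  whole : SubChart C
  whole = record
    { root    = start
    ; Vertex  = λ _ → ⊤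
    ; Trans   = λ (v , α , w) → (α , w) ∈ out v
    ; root∈   = tt
    ; source∈ = λ _ → tt
    ; target∈ = λ _ → tt
    ; Trans⊆  = λ t → t
    }

  module _ (D : SubChart C) (v : V) (U : Pred (Maybe A × V) 0ℓ) where
    open SubChart D

    -- The set U of transitions from v, given by their labels and targets.
    Entry : Pred Transition 0ℓ
    Entry (x , α , y) = x ≡ v × U (α , y)

    -- Transitions on paths that start with a transition in U and stop as soon
    -- as v is reached again.
    data OnPath : Pred Transition 0ℓ where
      entry : ∀ {α y} → U (α , y) → OnPath (v , α , y)
      next  : ∀ {x α y β z} → OnPath (x , α , y) → y ≢ v →
              Trans (y , β , z) → OnPath (y , β , z)

    data OnPathVertex : Pred V 0ℓ where
      base   : OnPathVertex v
      target : ∀ {x α y} → OnPath (x , α , y) → OnPathVertex y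

    generated : (∀ {α y} → U (α , y) → Trans (v , α , y)) → SubChart C
    generated U⊆ = record
      { root    = v
      ; Vertex  = OnPathVertex
      ; Trans   = OnPath
      ; root∈   = base
      ; source∈ = λ { (entry _) → base ; (next p _ _) → target p }
      ; target∈ = target
      ; Trans⊆  = λ { (entry u) → Trans⊆ (U⊆ u) ; (next _ _ t) → Trans⊆ t }
      }

    Body : Pred Transition 0ℓ
    Body t = OnPath t × ¬ Entry t

    Kept : Rel V 0ℓ
    Kept x y = ∃[ α ] (Trans (x , α , y) × ¬ Entry (x , α , y))

    eliminate : SubChart C
    eliminate = record
      { root    = root
      ; Vertex  = Star Kept root
      ; Trans   = λ t → Trans t × ¬ Entry t × Star Kept root (proj₁ t)
      ; root∈   = ε
      ; source∈ = λ (_ , _ , r) → r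
      ; target∈ = λ (t , ¬u , r) → r ◅◅ ((_ , t , ¬u) ◅ ε)
      ; Trans⊆  = λ (t , _ , _) → Trans⊆ t
      }

  record LoopSubChart (D : SubChart C) : Set₁ where
    field
      v        : V
      U        : Pred (Maybe A × V) 0ℓ
      U⊆       : ∀ {α y} → U (α , y) → SubChart.Trans D (v , α , y)
      nonempty : Satisfiable U
      isLoop   : SubChart.IsLoop (generated D v U U⊆)

    loopEntry : Pred Transition 0ℓ
    loopEntry = Entry D v U

    loopBody : Pred Transition 0ℓ
    loopBody = Body D v U

    eliminated : SubChart C
    eliminated = eliminate D v U

  open LoopSubChart using (loopEntry; loopBody; eliminated)

  data Eliminations (D : SubChart C) : Set₁ where
    done : Eliminations D
    step : (L : LoopSubChart D) → Eliminations (eliminated L) → Eliminations D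

  final : ∀ {D} → Eliminations D → SubChart C
  final {D} done       = D
  final     (step L s) = final s

  -- No transition in P is a loop-entry transition of one of the eliminations.
  EntriesAvoid : ∀ {D} → Pred Transition 0ℓ → Eliminations D → Set
  EntriesAvoid P done       = ⊤
  EntriesAvoid P (step L s) = (∀ t → loopEntry L t → ¬ P t) × EntriesAvoid P s

  Layered : ∀ {D} → Eliminations D → Set
  Layered done       = ⊤
  Layered (step L s) = EntriesAvoid (loopBody L) s × Layered s

LLEE : {A : Set} → OneChart A → Set₁
LLEE C = Σ[ s ∈ Eliminations (whole {C = C}) ]
           ((∀ p → ¬ SubChart.InfinitePath (final s) p) × Layered s)

label : {A : Set} → Maybe A → StExp A
label nothing  = 𝟏
label (just a) = act a

module _ {A : Set} {a r : Level} (S : System A a r) (C : OneChart A) where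
  open OneChart C

  τ : V → StExp A
  τ v = if terminates v then 𝟏 else 𝟎

  ProvableSolution : (V → StExp A) → Set (a ⊔ r)
  ProvableSolution s =
    ∀ v → S ⊢ s v ≐ τ v + ∑ (map (λ (α , w) → label α · s w) (out v))

record CoProof {A : Set} {a r : Level} (S : System A a r) (E : Equation A) :
               Set (lsuc 0ℓ ⊔ a ⊔ r) where
  field
    chart   : OneChart A
  open OneChart chart
  field
    guarded : WeaklyGuarded
    L       : V → Equation A
    sol₁    : ProvableSolution S chart (lhs ∘ L)
    sol₂    : ProvableSolution S chart (rhs ∘ L)
    start₁  : lhs E ≡ lhs (L start)
    start₂  : rhs E ≡ rhs (L start)

record LCoProof₁ {A : Set} (P E : Equation A) : Set₁ where
  field
    proof     : CoProof (Mil⁻+ ｛ P ｝) E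
    witnessed : LLEE (CoProof.chart proof)

cMil₁ : (A : Set) → System A 0ℓ (lsuc 0ℓ)
cMil₁ A = record { Axiom = Mil⁻Axiom ; Rule = LCoProof₁ }

{-# OPTIONS --safe #-}

-- RSP* becomes one coinductive proof.  Cut a star expression into the positions
-- reached after at least one action.  If f is not nullable, every x with
-- x = f · x + g yields a provable solution of the chart on the positions of
-- f * · g: a position of f with residual r is mapped to r · x, the vertex to
-- which the iterations of f return to x, and positions of g to their residuals.
-- Both e, by the premise, and f * · g, in Mil⁻, are such an x.  The chart is
-- LLEE: at the vertex v of a starred subexpression the transitions into its
-- positions are the loop entries, all other transitions increase a rank, and
-- these positions rank below v; so loops are eliminated in order of rank.
module Submission where

open import Defs
open import Algebra.Bundles using (CommutativeMonoid)
open import Data.Bool using (T; Bool; true; false; _∧_; _∨_; if_then_else_)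
open import Data.Bool.Properties using (T-∧; ∧-zeroʳ; ¬-not)
open import Data.Empty using (⊥)
open import Data.Fin using (toℕ; fromℕ<; Fin)
open import Data.Fin.Properties using (inj⇒≟; toℕ-injective; toℕ-fromℕ<; toℕ<n; 0↔⊥; 1↔⊤; +↔⊎; toℕ-↑ˡ; toℕ-↑ʳ)
open import Data.List using (List; []; _∷_; map; allFin; _++_)
open import Data.List.Membership.Propositional using (_∈_; find; lose)
open import Data.List.Membership.Propositional.Properties using (∈-map⁺; ∈-allFin; ∈-map⁻; ∈-++⁻)
open import Data.List.Properties using (map-∘; ++-identityʳ)
open import Data.List.Relation.Unary.Any as Any using (Any; here; there; satisfied)
open import Data.Maybe using (Maybe; just; nothing; Is-just)
open import Data.Maybe.Relation.Unary.Any using (just)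
open import Data.Nat as ℕ using (ℕ; zero; suc; _≤_; _<_)
open import Data.Nat.Properties using (≤-trans; <-≤-trans; <-trans; <-irrefl; m<1+n⇒m<n∨m≡n; m<n⇒m<1+n; m≤m+n; m≤n+m; ≤-reflexive; +-identityʳ; +-suc; +-monoʳ-≤; +-monoˡ-≤; module ≤-Reasoning; +-monoʳ-<)
open import Data.Product using (∃-syntax; Σ-syntax; _×_; _,_; proj₁; proj₂; map₂)
open import Data.Sum as Sum using (_⊎_; inj₁; inj₂)
open import Data.Sum.Function.Propositional using (_⊎-↔_)
open import Data.Sum.Relation.Binary.LeftOrder using (_⊎-<_; ₁∼₂; ₁∼₁; ₂∼₂; ⊎-<-decidable)
open import Data.Sum.Relation.Binary.Pointwise using (Pointwise; inj₁; inj₂; ⊎-decidable)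
open import Data.Unit using (tt; ⊤)
open import Function using (_∘_; Inverse; _↔_; Equivalence)
open import Function.Construct.Composition using (_↔-∘_)
open import Function.Construct.Symmetry using (↔-sym)
open import Function.Properties.Inverse using (↔⇒↣)
open import Level using (0ℓ)
open import Relation.Binary using (Rel; Decidable; DecidableEquality)
open import Relation.Binary.Construct.Closure.ReflexiveTransitive using (Star; ε; _◅_)
open import Relation.Binary.Construct.Closure.Transitive using (TransClosure; [_]; _∷_)
open import Relation.Binary.Construct.Never using (Never)
open import Relation.Binary.PropositionalEquality using (_≡_; refl; sym; trans; cong; subst; subst₂)
open import Relation.Nullary using (¬_; Dec; yes; no; contradiction)
open import Relation.Nullary.Decidable using (map′; _×-dec_; _⊎-dec_; ¬?)
open import Relation.Unary using (Pred; ｛_｝)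

-- Decidable reachability on finite vertex sets.

data Via {V : Set} (R : Rel V 0ℓ) (zs : List V) : Rel V 0ℓ where
  direct : ∀ {x y} → R x y → Via R zs x y
  via    : ∀ {x z y} → R x z → z ∈ zs → Via R zs z y → Via R zs x y

module _ {V : Set} {R : Rel V 0ℓ} where

  Via-trans : ∀ {zs x z y} → z ∈ zs → Via R zs x z → Via R zs z y → Via R zs x y
  Via-trans z∈ (direct r)    q = via r z∈ q
  Via-trans z∈ (via r w∈ p) q = via r w∈ (Via-trans z∈ p q)

  Via-weaken : ∀ {zs z x y} → Via R zs x y → Via R (z ∷ zs) x y
  Via-weaken (direct r)   = direct r
  Via-weaken (via r w∈ p) = via r (there w∈) (Via-weaken p)

  -- One visit to `z` is enough: detours from `z` back to `z` are dropped, so both remaining pieces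
  -- avoid `z` as an intermediate point.
  Via-split : ∀ {zs z x y} → Via R (z ∷ zs) x y → Via R zs x y ⊎ (Via R zs x z × Via R zs z y)
  Via-split (direct r) = inj₁ (direct r)
  Via-split (via r w∈ p) with w∈ | Via-split p
  ... | here refl | inj₁ q        = inj₂ (direct r , q)
  ... | here refl | inj₂ (_ , q)  = inj₂ (direct r , q)
  ... | there w∈′ | inj₁ q        = inj₁ (via r w∈′ q)
  ... | there w∈′ | inj₂ (q , q′) = inj₂ (via r w∈′ q , q′)

  -- Warshall's algorithm: the set of allowed intermediate points grows by one.
  via? : Decidable R → ∀ zs → Decidable (Via R zs)
  via? R? []       x y = map′ direct (λ { (direct r) → r ; (via _ () _) }) (R? x y)
  via? R? (z ∷ zs) x y =
    map′ (λ { (inj₁ p)       → Via-weaken p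
            ; (inj₂ (p , q)) → Via-trans (here refl) (Via-weaken p) (Via-weaken q) })
         Via-split
         (via? R? zs x y ⊎-dec (via? R? zs x z ×-dec via? R? zs z y))

  Via⇒Star : ∀ {zs x y} → Via R zs x y → Star R x y
  Via⇒Star (direct r)  = r ◅ ε
  Via⇒Star (via r _ p) = r ◅ Via⇒Star p

  Star⇒Via : ∀ {zs} → (∀ z → z ∈ zs) → ∀ {x y} → Star R x y → x ≡ y ⊎ Via R zs x y
  Star⇒Via all ε       = inj₁ refl
  Star⇒Via all (r ◅ p) with Star⇒Via all p
  ... | inj₁ refl = inj₂ (direct r)
  ... | inj₂ q    = inj₂ (via r (all _) q)

  star? : DecidableEquality V → ∀ zs → (∀ z → z ∈ zs) → Decidable R → Decidable (Star R)
  star? _≟_ zs all R? x y =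
    map′ (λ { (inj₁ refl) → ε ; (inj₂ p) → Via⇒Star p }) (Star⇒Via all)
         (x ≟ y ⊎-dec via? R? zs x y)

  walk : (Q : Pred V 0ℓ) → (∀ {x} → Q x → ∃[ y ] (R x y × Q y)) →
         ∀ {x} → Q x → Σ[ p ∈ (ℕ → V) ] ((∀ i → R (p i) (p (suc i))) × p 0 ≡ x)
  walk Q move {x} q = (λ i → proj₁ (at i)) , (λ i → proj₁ (proj₂ (move (proj₂ (at i))))) , refl
    where
    at : ℕ → ∃[ y ] Q y
    at zero    = x , q
    at (suc i) = _ , proj₂ (proj₂ (move (proj₂ (at i))))

module Finite {A : Set} (C : OneChart A) where
  open OneChart C

  index : V → ℕ
  index v = toℕ (Inverse.to finite v)

  index<size : ∀ v → index v < size
  index<size v = toℕ<n (Inverse.to finite v)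

  index-injective : ∀ {v w} → index v ≡ index w → v ≡ w
  index-injective eq =
    trans (sym (Inverse.strictlyInverseʳ finite _))
          (trans (cong (Inverse.from finite) (toℕ-injective eq)) (Inverse.strictlyInverseʳ finite _))

  vertex : ∀ {k} → k < size → V
  vertex k< = Inverse.from finite (fromℕ< k<)

  index-vertex : ∀ {k} (k< : k < size) → index (vertex k<) ≡ k
  index-vertex k< = trans (cong toℕ (Inverse.strictlyInverseˡ finite _)) (toℕ-fromℕ< k<)

  _≟_ : DecidableEquality V
  _≟_ = inj⇒≟ (↔⇒↣ finite)

  vertices : List V
  vertices = map (Inverse.from finite) (allFin size)

  ∈-vertices : ∀ v → v ∈ vertices
  ∈-vertices v = subst (_∈ vertices) (Inverse.strictlyInverseʳ finite v)
                       (∈-map⁺ (Inverse.from finite) (∈-allFin (Inverse.to finite v)))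

  ∃? : {P : Pred V 0ℓ} → (∀ v → Dec (P v)) → Dec (∃[ v ] P v)
  ∃? P? = map′ satisfied (λ (v , pv) → lose (∈-vertices v) pv) (Any.any? P? vertices)

-- Loop elimination for 1-charts with nested loops.

-- x ◁ v says that x lies inside the loop at v; the loop-entry transitions at v
-- are those that lead from v to some x ◁ v.
record Nesting {A : Set} (C : OneChart A) : Set₁ where
  open OneChart C
  open Finite C
  field
    _◁_     : Rel V 0ℓ
    _◁?_    : Decidable _◁_
    ◁-index : ∀ {x v} → x ◁ v → index x < index v
    ◁-exit  : ∀ {x v α y} → x ◁ v → (α , y) ∈ out x → y ≡ v ⊎ y ◁ v
    ◁-¬term : ∀ {x v} → x ◁ v → ¬ T (terminates x)
    forward : ∀ {x α y} → (α , y) ∈ out x → y ◁ x ⊎ index x < index y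

module _ {A : Set} {C : OneChart A} (N : Nesting C) where
  open OneChart C
  open Finite C
  open Nesting N

  Edge : SubChart C → Rel V 0ℓ
  Edge D x y = ∃[ α ] SubChart.Trans D (x , α , y)

  NoInfinitePath : SubChart C → Set
  NoInfinitePath D = ∀ p → ¬ SubChart.InfinitePath D p

  -- The invariant of the elimination, with `k` running from 0 to `size`. It speaks of infinite
  -- paths instead of absent transitions because loop-entry transitions without a path back may
  -- remain in `D`.
  Settled : ℕ → SubChart C → Set
  Settled k D = ∀ p → SubChart.InfinitePath D p → index (p 0) < k → ¬ (p 1 ◁ p 0)

  module _ (D : SubChart C) where
    open SubChart D

    segment : ∀ {p} → InfinitePath p → ∀ m → Star (Edge D) (p 0) (p m)
    segment path zero    = ε
    segment path (suc m) = path 0 ◅ segment (λ i → path (suc i)) m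

    ascend : ∀ {k} → Settled k D → ∀ {p} → InfinitePath p → index (p 0) < k →
             index (p 0) < index (p 1)
    ascend settled {p} path <k with forward (Trans⊆ (proj₂ (path 0)))
    ... | inj₁ p₁◁p₀ = contradiction p₁◁p₀ (settled p path <k)
    ... | inj₂ p₀<p₁ = p₀<p₁

    -- Inside the loop at v the index increases along an infinite path, so that
    -- the path has to return to v.
    return : ∀ {v} → Settled (index v) D → ∀ {p} → InfinitePath p → p 0 ◁ v →
             ∃[ m ] p (suc m) ≡ v
    return {v} settled {p} path p₀◁ = search (index v) path p₀◁ (m≤m+n _ _)
      where
      -- `fuel` bounds how far the current index lies below that of `v`; with no fuel left the
      -- position could not be inside the loop.
      search : ∀ fuel {p} → InfinitePath p → p 0 ◁ v → index v ≤ fuel ℕ.+ index (p 0) →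
               ∃[ m ] p (suc m) ≡ v
      search zero    path p₀◁ v≤ = contradiction (<-≤-trans (◁-index p₀◁) v≤) (<-irrefl refl)
      search (suc fuel) {p} path p₀◁ v≤ with ◁-exit p₀◁ (Trans⊆ (proj₂ (path 0)))
      ... | inj₁ p₁≡v = 0 , p₁≡v
      ... | inj₂ p₁◁
        with m , eq ← search fuel (λ i → path (suc i)) p₁◁
               (≤-trans v≤ (subst (ℕ._≤ fuel ℕ.+ index (p 1)) (+-suc fuel _)
                             (+-monoʳ-≤ fuel (ascend settled path (◁-index p₀◁)))))
        = suc m , eq

    -- Every step of an infinite path would increase the index, so after `size` steps the index
    -- would be out of range.
    settled-all : Settled size D → NoInfinitePath D
    settled-all settled p path =
      <-irrefl refl (<-≤-trans (index<size (p size)) (≤-trans (m≤n+m size _) (climb size path)))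
      where
      climb : ∀ i {p} → InfinitePath p → index (p 0) ℕ.+ i ≤ index (p i)
      climb zero    path = ≤-reflexive (+-identityʳ _)
      climb (suc i) {p} path = begin
        index (p 0) ℕ.+ suc i   ≡⟨ +-suc _ i ⟩
        suc (index (p 0)) ℕ.+ i ≤⟨ +-monoˡ-≤ i (ascend settled path (index<size _)) ⟩
        index (p 1) ℕ.+ i       ≤⟨ climb i (λ j → path (suc j)) ⟩
        index (p (suc i))       ∎
        where open ≤-Reasoning

  module _ (D : SubChart C) (v : V) where
    open SubChart D

    Inward : Pred (Maybe A × V) 0ℓ
    Inward (α , y) = Trans (v , α , y) × y ◁ v

    private
      G : SubChart C
      G = generated D v Inward proj₁

    OnPath⇒Trans : ∀ {t} → OnPath D v Inward t → Trans t
    OnPath⇒Trans (entry (t , _)) = t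
    OnPath⇒Trans (next _ _ t)    = t

    -- Proved together with `OnPath-target`: by `◁-exit`, a path that has entered the loop can leave
    -- it only at `v`, and there it stops.
    OnPath-source : ∀ {x α y} → OnPath D v Inward (x , α , y) →
                    (x ≡ v × Inward (α , y)) ⊎ x ◁ v
    OnPath-target : ∀ {x α y} → OnPath D v Inward (x , α , y) → y ≡ v ⊎ y ◁ v

    OnPath-source (entry u) = inj₁ (refl , u)
    OnPath-source (next p y≢v _) with OnPath-target p
    ... | inj₁ y≡v = contradiction y≡v y≢v
    ... | inj₂ y◁v = inj₂ y◁v

    OnPath-target (entry (_ , y◁v)) = inj₂ y◁v
    OnPath-target (next p y≢v t) with OnPath-target p
    ... | inj₁ y≡v = contradiction y≡v y≢v
    ... | inj₂ y◁v = ◁-exit y◁v (Trans⊆ t)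

    -- The source of layeredness: later loop-entry transitions start at vertices of index greater
    -- than that of `v`.
    Body-index : ∀ t → Body D v Inward t → index (proj₁ t) < index v
    Body-index (x , _) (p , ¬entry) with OnPath-source p
    ... | inj₁ e   = contradiction e ¬entry
    ... | inj₂ x◁v = ◁-index x◁v

    -- Once the loops at smaller indices are settled, this decides whether (L1) holds at `v` or no
    -- infinite path starts by entering the loop at `v`.
    Returning : Set
    Returning = ∃[ y ] (Edge D v y × y ◁ v × Star (Edge D) y v)

    returning? : Decidable (Edge D) → Dec Returning
    returning? Edge? =
      ∃? (λ y → Edge? v y ×-dec y ◁? v ×-dec star? _≟_ vertices ∈-vertices Edge? y v)

    -- The path back to `v` is cut at its first visit to `v`, since `next` does not continue beyond
    -- `v`.
    cycle : ∀ {x α y} → OnPath D v Inward (x , α , y) → Star (Edge D) y v →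
            TransClosure (Edge G) x v
    cycle {y = y} p ps with y ≟ v
    cycle p ps              | yes refl = [ _ , p ]
    cycle p ε               | no y≢v   = contradiction refl y≢v
    cycle p ((_ , t) ◅ ps) | no y≢v   = (_ , p) ∷ cycle (next p y≢v t) ps

    loop : Settled (index v) D → Returning → LoopSubChart D
    loop settled (y , (α , t) , y◁v , ps) = record
      { v = v ; U = Inward ; U⊆ = proj₁ ; nonempty = _ , t , y◁v
      ; isLoop = record { L1 = infinite ; L2 = returns ; L3 = nonterminating } }
      where
      v→v : TransClosure (Edge G) v v
      v→v = cycle (entry (t , y◁v)) ps

      continue : ∀ {x} → TransClosure (Edge G) x v → ∃[ z ] (Edge G x z × TransClosure (Edge G) z v)
      -- The last edge reaches `v`, where the cycle starts over.
      continue [ e ]    = _ , e , v→v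
      continue (e ∷ es) = _ , e , es

      infinite : ∃[ p ] (SubChart.InfinitePath G p × p 0 ≡ v)
      infinite = walk (λ x → TransClosure (Edge G) x v) continue v→v

      returns : ∀ p → SubChart.InfinitePath G p → p 0 ≡ v → ∃[ n ] p (suc n) ≡ v
      returns p path refl with OnPath-source (proj₂ (path 0))
      ... | inj₂ v◁v = contradiction (◁-index v◁v) (<-irrefl refl)
      ... | inj₁ (_ , _ , p₁◁v)
        with m , eq ← return D settled {λ i → p (suc i)} (λ i → _ , OnPath⇒Trans (proj₂ (path (suc i)))) p₁◁v
        = suc m , eq

      nonterminating : ∀ x → SubChart.Vertex G x → T (terminates x) → x ≡ v
      nonterminating x base       _  = refl
      nonterminating x (target p) t↓ with OnPath-target p
      ... | inj₁ x≡v = x≡v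
      ... | inj₂ x◁v = contradiction t↓ (◁-¬term x◁v)

    -- Decidability has to survive an elimination, because `returning?` is asked again at the next
    -- vertex in the chart that is left.
    Edge?-eliminate : Decidable (Edge D) → Decidable (Edge (eliminate D v Inward))
    Edge?-eliminate Edge? x y =
      map′ (λ (k , r) → proj₁ k , proj₁ (proj₂ k) , proj₂ (proj₂ k) , r)
           (λ (α , t , ¬e , r) → (α , t , ¬e) , r)
           (Kept? x y ×-dec star? _≟_ vertices ∈-vertices Kept? root x)
      where
      -- Whether a transition of `D` is a loop entry depends only on its source and target, so
      -- labels need not be inspected.
      Kept? : Decidable (Kept D v Inward)
      Kept? x y =
        map′ (λ ((α , t) , ¬e) → α , t , λ { (x≡v , _ , y◁v) → ¬e (x≡v , y◁v) })
             (λ { (α , t , ¬e) → (α , t) , λ { (refl , y◁v) → ¬e (refl , t , y◁v) } })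
             (Edge? x y ×-dec ¬? (x ≟ v ×-dec y ◁? v))

    -- An infinite path entering the loop at `v` would come back to `v` by `return`, and its initial
    -- segment would witness `Returning`.
    settled-skip : Settled (index v) D → ¬ Returning → Settled (suc (index v)) D
    settled-skip settled ¬ret p path p₀< p₁◁p₀ with m<1+n⇒m<n∨m≡n p₀<
    ... | inj₁ p₀<v = settled p path p₀<v p₁◁p₀
    ... | inj₂ eq with refl ← index-injective eq
                  with m , back ← return D settled {λ i → p (suc i)} (λ i → path (suc i)) p₁◁p₀
      = ¬ret (p 1 , path 0 , p₁◁p₀ , subst (Star (Edge D) (p 1)) back
                          (segment D {λ i → p (suc i)} (λ i → path (suc i)) (suc m)))

    settled-eliminate : Settled (index v) D → Settled (suc (index v)) (eliminate D v Inward)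
    settled-eliminate settled p path p₀< p₁◁p₀ with m<1+n⇒m<n∨m≡n p₀<
    ... | inj₁ p₀<v = settled p (λ i → _ , proj₁ (proj₂ (path i))) p₀<v p₁◁p₀
    ... | inj₂ eq with refl ← index-injective eq | α , t , ¬e , _ ← path 0 = ¬e (refl , t , p₁◁p₀)

  -- `avoids` strengthens the induction: it forces the loop entries of `steps` to start at index `k`
  -- or above, whereas the loop bodies of eliminations made before start below `k`.
  record Elimination (k : ℕ) (D : SubChart C) : Set₁ where
    field
      steps   : Eliminations D
      acyclic : NoInfinitePath (final steps)
      layered : Layered steps
      avoids  : ∀ P → (∀ t → P t → index (proj₁ t) < k) → EntriesAvoid P steps

  -- `m` counts the vertices still to be treated. `eliminateAt` takes the vertex itself in place of
  -- `k`, which confines all transport along `index≡k` to `eliminateFrom`.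
  eliminateFrom : ∀ m {k} → m ℕ.+ k ≡ size →
                  ∀ D → Decidable (Edge D) → Settled k D → Elimination k D
  eliminateAt   : ∀ m v → m ℕ.+ suc (index v) ≡ size →
                  ∀ D → Decidable (Edge D) → Settled (index v) D → Elimination (index v) D

  eliminateFrom zero    refl D Edge? settled = record
    { steps = done ; acyclic = settled-all D settled ; layered = tt ; avoids = λ _ _ → tt }
  eliminateFrom (suc m) {k} m+k≡ D Edge? settled =
    subst (λ j → Elimination j D) index≡k
      (eliminateAt m (vertex k<size)
        (trans (cong (λ j → m ℕ.+ suc j) index≡k) (trans (+-suc m k) m+k≡))
        D Edge? (subst (λ j → Settled j D) (sym index≡k) settled))
    where
    k<size : k < size
    k<size = subst (k <_) m+k≡ (ℕ.s≤s (m≤n+m k m))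

    index≡k : index (vertex k<size) ≡ k
    index≡k = index-vertex k<size

  -- If no path leads back to v from inside its loop, then its loop-entry
  -- transitions do not generate a loop sub-1-chart, and they may remain.
  eliminateAt m v m+v≡ D Edge? settled with returning? D v Edge?
  ... | no ¬ret = record
    { steps = steps ; acyclic = acyclic ; layered = layered
    ; avoids = λ P P< → avoids P (λ t Pt → m<n⇒m<1+n (P< t Pt)) }
    where open Elimination (eliminateFrom m m+v≡ D Edge? (settled-skip D v settled ¬ret))
  ... | yes ret = record
    { steps = step (loop D v settled ret) steps
    ; acyclic = acyclic
    ; layered = avoids (Body D v (Inward D v)) (λ t b → m<n⇒m<1+n (Body-index D v t b)) , layered
    ; avoids = λ P P< → (λ { t (refl , _) Pt → <-irrefl refl (P< t Pt) })
                      , avoids P (λ t Pt → m<n⇒m<1+n (P< t Pt)) }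
    where open Elimination (eliminateFrom m m+v≡ (eliminate D v (Inward D v))
                             (Edge?-eliminate D v Edge?) (settled-eliminate D v settled))

  nesting⇒LLEE : LLEE C
  nesting⇒LLEE = steps , acyclic , layered
    where
    Edge? : Decidable (Edge whole)
    Edge? x y = map′ found (λ (_ , y∈) → lose y∈ refl) (Any.any? (λ t → proj₂ t ≟ y) (out x))
      where
      found : Any (λ t → proj₂ t ≡ y) (out x) → Edge whole x y
      found e with _ , t∈ , refl ← find e = _ , t∈

    open Elimination (eliminateFrom size (+-identityʳ size) whole Edge? (λ _ _ ()))

-- The chart on the positions of a star expression.

module _ {A : Set} where

  nullable : StExp A → Bool
  nullable 𝟎       = false
  nullable 𝟏       = true
  nullable (act a) = false
  nullable (e + f) = nullable e ∨ nullable f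
  nullable (e · f) = nullable e ∧ nullable f
  nullable (e *)   = true

  -- Its contrapositive turns the side condition of `rsp*` into `nullable f ≡ false`.
  nullable⇒↓ : ∀ e → T (nullable e) → e ↓
  nullable⇒↓ 𝟏       _ = 𝟏↓
  nullable⇒↓ (e + f) n with nullable e in eq
  ... | true  = +↓ₗ (nullable⇒↓ e (subst T (sym eq) tt))
  ... | false = +↓ᵣ (nullable⇒↓ f n)
  nullable⇒↓ (e · f) n with nullable e in eq
  ... | true  = ·↓ (nullable⇒↓ e (subst T (sym eq) tt)) (nullable⇒↓ f n)
  nullable⇒↓ (e *)   _ = *↓

  -- The positions reached by performing at least one action of e; for e * these
  -- are the positions of e and the vertex to which an iteration returns.
  Pos : StExp A → Set
  Pos 𝟎       = ⊥
  Pos 𝟏       = ⊥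
  Pos (act a) = ⊤
  Pos (e + f) = Pos e ⊎ Pos f
  Pos (e · f) = Pos e ⊎ Pos f
  Pos (e *)   = Pos e ⊎ ⊤

  Moves : Set → Set
  Moves X = List (Maybe A × X)

  moveˡ : ∀ {X Y} → Moves X → Moves (X ⊎ Y)
  moveˡ = map (map₂ inj₁)

  moveʳ : ∀ {X Y} → Moves Y → Moves (X ⊎ Y)
  moveʳ = map (map₂ inj₂)

  -- Shared by products and stars: `ys` becomes available when the first component can terminate.
  -- For a star it is the single 1-transition to the returning vertex.
  _▸_if_ : ∀ {X Y} → Moves X → Moves Y → Bool → Moves (X ⊎ Y)
  xs ▸ ys if b = moveˡ xs ++ (if b then moveʳ ys else [])

  initial : ∀ e → Moves (Pos e)
  initial 𝟎       = []
  initial 𝟏       = []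
  initial (act a) = (just a , tt) ∷ []
  initial (e + f) = moveˡ (initial e) ++ moveʳ (initial f)
  initial (e · f) = initial e ▸ initial f if nullable e
  initial (e *)   = moveˡ (initial e)

  final? : ∀ e → Pos e → Bool
  final? (act a) _        = true
  final? (e + f) (inj₁ p) = final? e p
  final? (e + f) (inj₂ q) = final? f q
  final? (e · f) (inj₁ p) = final? e p ∧ nullable f
  final? (e · f) (inj₂ q) = final? f q
  -- Inside a star, termination is possible only after the 1-transition back to its vertex; this
  -- gives (L3).
  final? (e *)   (inj₁ p) = false
  final? (e *)   (inj₂ _) = true

  moves : ∀ e → Pos e → Moves (Pos e)
  moves (act a) _        = []
  moves (e + f) (inj₁ p) = moveˡ (moves e p)
  moves (e + f) (inj₂ q) = moveʳ (moves f q)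
  moves (e · f) (inj₁ p) = moves e p ▸ initial f if final? e p
  moves (e · f) (inj₂ q) = moveʳ (moves f q)
  moves (e *)   (inj₁ p) = moves e p ▸ (nothing , tt) ∷ [] if final? e p
  moves (e *)   (inj₂ _) = moveˡ (initial e)

  count : StExp A → ℕ
  count 𝟎       = 0
  count 𝟏       = 0
  count (act a) = 1
  count (e + f) = count e ℕ.+ count f
  count (e · f) = count e ℕ.+ count f
  count (e *)   = count e ℕ.+ 1

  Pos↔Fin : ∀ e → Pos e ↔ Fin (count e)
  Pos↔Fin 𝟎       = ↔-sym 0↔⊥
  Pos↔Fin 𝟏       = ↔-sym 0↔⊥
  Pos↔Fin (act a) = ↔-sym 1↔⊤
  Pos↔Fin (e + f) = ↔-sym +↔⊎ ↔-∘ (Pos↔Fin e ⊎-↔ Pos↔Fin f)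
  Pos↔Fin (e · f) = ↔-sym +↔⊎ ↔-∘ (Pos↔Fin e ⊎-↔ Pos↔Fin f)
  Pos↔Fin (e *)   = ↔-sym +↔⊎ ↔-∘ (Pos↔Fin e ⊎-↔ ↔-sym 1↔⊤)

  -- A recursive form of the index given by `Pos↔Fin`, with the vertex of a star after all positions
  -- of its body. The summand 0 in the last clause is the form that `toℕ-↑ʳ` yields.
  rank : ∀ e → Pos e → ℕ
  rank (act a) _        = 0
  rank (e + f) (inj₁ p) = rank e p
  rank (e + f) (inj₂ q) = count e ℕ.+ rank f q
  rank (e · f) (inj₁ p) = rank e p
  rank (e · f) (inj₂ q) = count e ℕ.+ rank f q
  rank (e *)   (inj₁ p) = rank e p
  rank (e *)   (inj₂ _) = count e ℕ.+ 0

  toℕ-Pos↔Fin : ∀ e p → toℕ (Inverse.to (Pos↔Fin e) p) ≡ rank e p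
  toℕ-Pos↔Fin (act a) _        = refl
  toℕ-Pos↔Fin (e + f) (inj₁ p) = trans (toℕ-↑ˡ _ (count f)) (toℕ-Pos↔Fin e p)
  toℕ-Pos↔Fin (e + f) (inj₂ q) = trans (toℕ-↑ʳ (count e) _) (cong (count e ℕ.+_) (toℕ-Pos↔Fin f q))
  toℕ-Pos↔Fin (e · f) (inj₁ p) = trans (toℕ-↑ˡ _ (count f)) (toℕ-Pos↔Fin e p)
  toℕ-Pos↔Fin (e · f) (inj₂ q) = trans (toℕ-↑ʳ (count e) _) (cong (count e ℕ.+_) (toℕ-Pos↔Fin f q))
  toℕ-Pos↔Fin (e *)   (inj₁ p) = trans (toℕ-↑ˡ _ 1) (toℕ-Pos↔Fin e p)
  toℕ-Pos↔Fin (e *)   (inj₂ _) = toℕ-↑ʳ (count e) _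

  rank-bound : ∀ e p n → rank e p < count e ℕ.+ n
  rank-bound e p n = <-≤-trans (subst (_< count e) (toℕ-Pos↔Fin e p) (toℕ<n _)) (m≤m+n (count e) n)

  -- Within e x v: x is an inner position of the iteration that returns to v.
  Within : ∀ e → Rel (Pos e) 0ℓ
  Within 𝟎       = Never
  Within 𝟏       = Never
  Within (act a) = Never
  Within (e + f) = Pointwise (Within e) (Within f)
  Within (e · f) = Pointwise (Within e) (Within f)
  Within (e *)   = Within e ⊎-< Never

  within? : ∀ e → Decidable (Within e)
  within? (act a) _ _ = no λ ()
  within? (e + f)     = ⊎-decidable (within? e) (within? f)
  within? (e · f)     = ⊎-decidable (within? e) (within? f)
  within? (e *)       = ⊎-<-decidable (within? e) (λ _ _ → no λ ())

  within-rank : ∀ e {x v} → Within e x v → rank e x < rank e v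
  within-rank (e + f) (inj₁ w) = within-rank e w
  within-rank (e + f) (inj₂ w) = +-monoʳ-< (count e) (within-rank f w)
  within-rank (e · f) (inj₁ w) = within-rank e w
  within-rank (e · f) (inj₂ w) = +-monoʳ-< (count e) (within-rank f w)
  within-rank (e *)   ₁∼₂      = rank-bound e _ 0
  within-rank (e *)   (₁∼₁ w)  = within-rank e w

  within-¬final : ∀ e {x v} → Within e x v → ¬ T (final? e x)
  within-¬final (e + f) (inj₁ w) = within-¬final e w
  within-¬final (e + f) (inj₂ w) = within-¬final f w
  within-¬final (e · f) {inj₁ x} (inj₁ w) t = within-¬final e w (proj₁ (T-∧ .Equivalence.to t))
  within-¬final (e · f) (inj₂ w) = within-¬final f w
  within-¬final (e *)   ₁∼₂      = λ ()
  within-¬final (e *)   (₁∼₁ w)  = λ ()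

  module _ {X Y : Set} where

    ∈-moveˡ⁻ : ∀ {xs : Moves X} {α} {y : X ⊎ Y} → (α , y) ∈ moveˡ xs →
               ∃[ p ] (y ≡ inj₁ p × (α , p) ∈ xs)
    ∈-moveˡ⁻ y∈ with _ , p∈ , refl ← ∈-map⁻ (map₂ inj₁) y∈ = _ , refl , p∈

    ∈-moveʳ⁻ : ∀ {ys : Moves Y} {α} {y : X ⊎ Y} → (α , y) ∈ moveʳ ys →
               ∃[ q ] (y ≡ inj₂ q × (α , q) ∈ ys)
    ∈-moveʳ⁻ y∈ with _ , q∈ , refl ← ∈-map⁻ (map₂ inj₂) y∈ = _ , refl , q∈

    ∈-▸⁻ : ∀ (xs : Moves X) (ys : Moves Y) b {α y} → (α , y) ∈ xs ▸ ys if b →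
           (∃[ p ] (y ≡ inj₁ p × (α , p) ∈ xs)) ⊎ (T b × ∃[ q ] (y ≡ inj₂ q × (α , q) ∈ ys))
    ∈-▸⁻ xs ys b y∈ with ∈-++⁻ (moveˡ xs) y∈
    ∈-▸⁻ xs ys b y∈    | inj₁ y∈ˡ = inj₁ (∈-moveˡ⁻ y∈ˡ)
    ∈-▸⁻ xs ys true y∈ | inj₂ y∈ʳ = inj₂ (tt , ∈-moveʳ⁻ y∈ʳ)

  initial-proper : ∀ e {α y} → (α , y) ∈ initial e → Is-just α
  initial-proper (act a) (here refl) = just tt
  initial-proper (e + f) y∈ with ∈-++⁻ (moveˡ (initial e)) y∈
  ... | inj₁ y∈ˡ with _ , _ , p∈ ← ∈-moveˡ⁻ y∈ˡ = initial-proper e p∈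
  ... | inj₂ y∈ʳ with _ , _ , q∈ ← ∈-moveʳ⁻ y∈ʳ = initial-proper f q∈
  initial-proper (e · f) y∈ with ∈-▸⁻ (initial e) (initial f) (nullable e) y∈
  ... | inj₁ (_ , _ , p∈)     = initial-proper e p∈
  ... | inj₂ (_ , _ , _ , q∈) = initial-proper f q∈
  initial-proper (e *) y∈ with _ , _ , p∈ ← ∈-moveˡ⁻ y∈ = initial-proper e p∈

  -- A position inside a loop is not final, by `within-¬final`, so neither the second factor of a
  -- product nor the return of an outer star is available there.
  within-exit : ∀ e {x v α y} → Within e x v → (α , y) ∈ moves e x → y ≡ v ⊎ Within e y v
  within-exit (e + f) (inj₁ w) y∈ with _ , refl , p∈ ← ∈-moveˡ⁻ y∈ =
    Sum.map (cong inj₁) inj₁ (within-exit e w p∈)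
  within-exit (e + f) (inj₂ w) y∈ with _ , refl , q∈ ← ∈-moveʳ⁻ y∈ =
    Sum.map (cong inj₂) inj₂ (within-exit f w q∈)
  within-exit (e · f) {inj₁ x} (inj₁ w) y∈ with ∈-▸⁻ (moves e x) (initial f) (final? e x) y∈
  ... | inj₁ (_ , refl , p∈) = Sum.map (cong inj₁) inj₁ (within-exit e w p∈)
  ... | inj₂ (t , _)         = contradiction t (within-¬final e w)
  within-exit (e · f) (inj₂ w) y∈ with _ , refl , q∈ ← ∈-moveʳ⁻ y∈ =
    Sum.map (cong inj₂) inj₂ (within-exit f w q∈)
  within-exit (e *) {inj₁ x} w y∈ with ∈-▸⁻ (moves e x) ((nothing , tt) ∷ []) (final? e x) y∈
  within-exit (e *) ₁∼₂     _ | inj₁ (_ , refl , _)  = inj₂ ₁∼₂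
  within-exit (e *) ₁∼₂     _ | inj₂ (_ , _ , refl , _) = inj₁ refl
  within-exit (e *) (₁∼₁ w) _ | inj₁ (_ , refl , p∈) = Sum.map (cong inj₁) ₁∼₁ (within-exit e w p∈)
  within-exit (e *) (₁∼₁ w) _ | inj₂ (t , _)         = contradiction t (within-¬final e w)
  within-exit (e *) {inj₂ _} (₂∼₂ ())

  -- The conjunct `Is-just α` serves weak guardedness: loop entries come from `initial` and are
  -- proper, so every 1-transition increases the rank.
  moves-forward : ∀ e {x α y} → (α , y) ∈ moves e x →
                  (Is-just α × Within e y x) ⊎ rank e x < rank e y
  moves-forward (e + f) {inj₁ x} y∈ with _ , refl , p∈ ← ∈-moveˡ⁻ y∈ =
    Sum.map₁ (map₂ inj₁) (moves-forward e p∈)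
  moves-forward (e + f) {inj₂ x} y∈ with _ , refl , q∈ ← ∈-moveʳ⁻ y∈ =
    Sum.map (map₂ inj₂) (+-monoʳ-< (count e)) (moves-forward f q∈)
  moves-forward (e · f) {inj₁ x} y∈ with ∈-▸⁻ (moves e x) (initial f) (final? e x) y∈
  ... | inj₁ (_ , refl , p∈)     = Sum.map₁ (map₂ inj₁) (moves-forward e p∈)
  ... | inj₂ (_ , _ , refl , _) = inj₂ (rank-bound e x _)
  moves-forward (e · f) {inj₂ x} y∈ with _ , refl , q∈ ← ∈-moveʳ⁻ y∈ =
    Sum.map (map₂ inj₂) (+-monoʳ-< (count e)) (moves-forward f q∈)
  moves-forward (e *) {inj₁ x} y∈ with ∈-▸⁻ (moves e x) ((nothing , tt) ∷ []) (final? e x) y∈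
  ... | inj₁ (_ , refl , p∈)     = Sum.map₁ (map₂ ₁∼₁) (moves-forward e p∈)
  ... | inj₂ (_ , _ , refl , _) = inj₂ (rank-bound e x 0)
  moves-forward (e *) {inj₂ _} y∈ with _ , refl , p∈ ← ∈-moveˡ⁻ y∈ =
    inj₁ (initial-proper e p∈ , ₁∼₂)

  chartOf : ∀ e → Pos e → OneChart A
  chartOf e p = record
    { V = Pos e ; size = count e ; finite = Pos↔Fin e ; start = p
    ; out = moves e ; terminates = final? e }

  chartOf-nesting : ∀ e p → Nesting (chartOf e p)
  chartOf-nesting e p = record
    { _◁_     = Within e
    ; _◁?_    = within? e
    ; ◁-index = λ w → to-index (within-rank e w)
    ; ◁-exit  = within-exit e
    ; ◁-¬term = within-¬final e
    ; forward = λ y∈ → Sum.map proj₂ to-index (moves-forward e y∈) }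
    where
    open Finite (chartOf e p)
    to-index : ∀ {x y} → rank e x < rank e y → index x < index y
    to-index = subst₂ _<_ (sym (toℕ-Pos↔Fin e _)) (sym (toℕ-Pos↔Fin e _))

  chartOf-guarded : ∀ e p → OneChart.WeaklyGuarded (chartOf e p)
  chartOf-guarded e p v cycle = <-irrefl refl (increase cycle)
    where
    open OneChart (chartOf e p)
    one-step : ∀ {x y} → OneStep x y → rank e x < rank e y
    one-step y∈ with moves-forward e y∈
    ... | inj₂ x<y = x<y

    increase : ∀ {x y} → TransClosure OneStep x y → rank e x < rank e y
    increase [ s ]    = one-step s
    increase (s ∷ ss) = <-trans (one-step s) (increase ss)

-- Provable solutions of the position chart.

module Solutions {A : Set} (Γ : Pred (Equation A) 0ℓ) where

  infix 4 _≈_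
  _≈_ : Rel (StExp A) 0ℓ
  e ≈ f = Mil⁻+ Γ ⊢ e ≐ f

  mil : ∀ {E} → Mil⁻Axiom E → Mil⁻+ Γ ⊢ E
  mil a = axiom (inj₁ a)

  +-congʳ : ∀ {e f g} → e ≈ f → e + g ≈ f + g
  +-congʳ = context (□ +ˡ _)

  +-congˡ : ∀ {e f g} → e ≈ f → g + e ≈ g + f
  +-congˡ = context (_ +ʳ □)

  ·-congʳ : ∀ {e f g} → e ≈ f → e · g ≈ f · g
  ·-congʳ = context (□ ·ˡ _)

  ·-congˡ : ∀ {e f g} → e ≈ f → g · e ≈ g · f
  ·-congˡ = context (_ ·ʳ □)

  *-cong : ∀ {e f} → e ≈ f → e * ≈ f *
  *-cong = context (□ *ᶜ)

  +-commutativeMonoid : CommutativeMonoid 0ℓ 0ℓ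
  +-commutativeMonoid = record
    { Carrier = StExp A ; _≈_ = _≈_ ; _∙_ = _+_ ; ε = 𝟎
    ; isCommutativeMonoid = record
      { isMonoid = record
        { isSemigroup = record
          { isMagma = record
            { isEquivalence = record { refl = reflₑ ; sym = symₑ ; trans = transₑ }
            ; ∙-cong = λ p q → transₑ (+-congʳ p) (+-congˡ q) }
          ; assoc = λ _ _ _ → mil +-assoc }
        ; identity = (λ _ → transₑ (mil +-comm) (mil +-neutral)) , λ _ → mil +-neutral }
      ; comm = λ _ _ → mil +-comm } }

  open CommutativeMonoid +-commutativeMonoid using (setoid; identityˡ; identityʳ; assoc; comm; ∙-cong; commutativeSemigroup; reflexive)
  open import Algebra.Properties.CommutativeSemigroup commutativeSemigroup using (interchange; xy∙z≈x∙zy)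
  open import Relation.Binary.Reasoning.Setoid setoid

  -- `δ (terminates v)` and `sum s (out v)` are definitionally the two summands in
  -- `ProvableSolution`.
  δ : Bool → StExp A
  δ b = if b then 𝟏 else 𝟎

  sum : {X : Set} → (X → StExp A) → Moves X → StExp A
  sum s xs = ∑ (map (λ (α , w) → label α · s w) xs)

  ∑-∷ : ∀ x xs → ∑ (x ∷ xs) ≈ x + ∑ xs
  ∑-∷ x []       = symₑ (identityʳ x)
  ∑-∷ x (y ∷ ys) = begin
    ∑ (x + y ∷ ys)   ≈⟨ ∑-∷ (x + y) ys ⟩
    (x + y) + ∑ ys   ≈⟨ assoc x y _ ⟩
    x + (y + ∑ ys)   ≈⟨ +-congˡ (∑-∷ y ys) ⟨
    x + ∑ (y ∷ ys)   ∎

  module _ {X : Set} (s : X → StExp A) where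

    sum-∷ : ∀ α w xs → sum s ((α , w) ∷ xs) ≈ label α · s w + sum s xs
    sum-∷ α w xs = ∑-∷ _ (map (λ (α , w) → label α · s w) xs)

    sum-++ : ∀ xs ys → sum s (xs ++ ys) ≈ sum s xs + sum s ys
    sum-++ []             ys = symₑ (identityˡ _)
    sum-++ ((α , w) ∷ xs) ys = begin
      sum s ((α , w) ∷ xs ++ ys)              ≈⟨ sum-∷ α w (xs ++ ys) ⟩
      label α · s w + sum s (xs ++ ys)        ≈⟨ +-congˡ (sum-++ xs ys) ⟩
      label α · s w + (sum s xs + sum s ys)   ≈⟨ assoc _ _ _ ⟨
      label α · s w + sum s xs + sum s ys     ≈⟨ +-congʳ (sum-∷ α w xs) ⟨
      sum s ((α , w) ∷ xs) + sum s ys         ∎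

    sum-· : ∀ xs f → sum s xs · f ≈ sum (λ w → s w · f) xs
    sum-· []             f = mil ·-zeroˡ
    sum-· ((α , w) ∷ xs) f = begin
      sum s ((α , w) ∷ xs) · f                         ≈⟨ ·-congʳ (sum-∷ α w xs) ⟩
      (label α · s w + sum s xs) · f                   ≈⟨ mil ·-distribʳ ⟩
      (label α · s w) · f + sum s xs · f               ≈⟨ ∙-cong (mil ·-assoc) (sum-· xs f) ⟩
      label α · (s w · f) + sum (λ x → s x · f) xs     ≈⟨ ∑-∷ _ (map (λ (β , x) → label β · (s x · f)) xs) ⟨
      sum (λ x → s x · f) ((α , w) ∷ xs)               ∎

    sum-map : {Y : Set} (g : Y → X) → ∀ ys → sum s (map (map₂ g) ys) ≈ sum (s ∘ g) ys
    sum-map g ys = reflexive (cong ∑ (sym (map-∘ ys)))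

    expand-· : ∀ xs {e f b} → e ≈ δ b + sum s xs → e · f ≈ δ b · f + sum (λ w → s w · f) xs
    expand-· xs {f = f} e≈ = transₑ (·-congʳ e≈) (transₑ (mil ·-distribʳ) (+-congˡ (sum-· xs f)))

    -- Unfolding `e *` directly could leave an unguarded summand `𝟏 · e *`. Hence the constant is
    -- first removed under the star, by `*-term` if it is `𝟏`.
    expand-* : ∀ xs {e b} → e ≈ δ b + sum s xs → e * ≈ 𝟏 + sum (λ w → s w · e *) xs
    expand-* xs {e} {b} e≈ = begin
      e *                                ≈⟨ e*≈ ⟩
      sum s xs *                         ≈⟨ mil *-unfold ⟩
      𝟏 + sum s xs · sum s xs *          ≈⟨ +-congˡ (·-congˡ e*≈) ⟨
      𝟏 + sum s xs · e *                 ≈⟨ +-congˡ (sum-· xs (e *)) ⟩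
      𝟏 + sum (λ w → s w · e *) xs       ∎
      where
      drop-δ : ∀ b {f} → (δ b + f) * ≈ f *
      drop-δ true  = symₑ (mil *-term)
      drop-δ false = *-cong (identityˡ _)

      e*≈ : e * ≈ sum s xs *
      e*≈ = transₑ (*-cong e≈) (drop-δ b)

  -- The summand `δ b · f` either is `f`, contributing its termination and its moves, or vanishes.
  -- The values `u` are arbitrary, so the law applies to `residual` and to `solution`.
  expand-▸ : ∀ {X Y : Set} (u : X ⊎ Y → StExp A) xs ys b c {e f} →
             e ≈ δ b · f + sum (u ∘ inj₁) xs → f ≈ δ c + sum (u ∘ inj₂) ys →
             e ≈ δ (b ∧ c) + sum u (xs ▸ ys if b)
  expand-▸ u xs ys true c {e} {f} e≈ f≈ = begin
    e                                                    ≈⟨ e≈ ⟩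
    𝟏 · f + sum (u ∘ inj₁) xs                            ≈⟨ +-congʳ (transₑ (mil ·-idˡ) f≈) ⟩
    δ c + sum (u ∘ inj₂) ys + sum (u ∘ inj₁) xs          ≈⟨ xy∙z≈x∙zy _ _ _ ⟩
    δ c + (sum (u ∘ inj₁) xs + sum (u ∘ inj₂) ys)        ≈⟨ +-congˡ (∙-cong (sum-map u inj₁ xs) (sum-map u inj₂ ys)) ⟨
    δ c + (sum u (moveˡ xs) + sum u (moveʳ ys))          ≈⟨ +-congˡ (sum-++ u (moveˡ xs) (moveʳ ys)) ⟨
    δ c + sum u (xs ▸ ys if true)                        ∎
  expand-▸ u xs ys false c {e} {f} e≈ f≈ = begin
    e                                   ≈⟨ e≈ ⟩
    𝟎 · f + sum (u ∘ inj₁) xs           ≈⟨ ∙-cong (mil ·-zeroˡ) (symₑ (sum-map u inj₁ xs)) ⟩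
    𝟎 + sum u (moveˡ xs)                ≡⟨ cong (λ zs → 𝟎 + sum u zs) (++-identityʳ (moveˡ xs)) ⟨
    𝟎 + sum u (xs ▸ ys if false)        ∎

  -- Here the second component of `expand-▸` is the lone 1-transition: `u (inj₂ tt)` equals
  -- `𝟎 + 𝟏 · u (inj₂ tt)`, so that `c` is `false`.
  expand-return : ∀ {X : Set} (u : X ⊎ ⊤ → StExp A) xs b {e} →
                  e ≈ δ b · u (inj₂ tt) + sum (u ∘ inj₁) xs →
                  e ≈ 𝟎 + sum u (xs ▸ (nothing , tt) ∷ [] if b)
  expand-return u xs b {e} e≈ =
    subst (λ c → e ≈ δ c + sum u (xs ▸ (nothing , tt) ∷ [] if b)) (∧-zeroʳ b)
      (expand-▸ u xs ((nothing , tt) ∷ []) b false e≈ (symₑ (transₑ (identityˡ _) (mil ·-idˡ))))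

  -- In the manner of Antimirov's partial derivatives, but indexed by positions.
  residual : ∀ e → Pos e → StExp A
  residual (act a) _        = 𝟏
  residual (e + f) (inj₁ p) = residual e p
  residual (e + f) (inj₂ q) = residual f q
  residual (e · f) (inj₁ p) = residual e p · f
  residual (e · f) (inj₂ q) = residual f q
  residual (e *)   (inj₁ p) = residual e p · e *
  residual (e *)   (inj₂ _) = e *

  -- With `expand-residual`, the fundamental theorem for star expressions, obtained from the axioms
  -- of `Mil⁻` only.
  expand-initial : ∀ e → e ≈ δ (nullable e) + sum (residual e) (initial e)
  expand-initial 𝟎       = symₑ (identityʳ 𝟎)
  expand-initial 𝟏       = symₑ (identityʳ 𝟏)
  expand-initial (act a) = symₑ (transₑ (identityˡ _) (mil ·-idʳ))
  expand-initial (e + f) = begin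
    e + f
      ≈⟨ ∙-cong (expand-initial e) (expand-initial f) ⟩
    (δ (nullable e) + sum (residual e) (initial e)) + (δ (nullable f) + sum (residual f) (initial f))
      ≈⟨ interchange _ _ _ _ ⟩
    (δ (nullable e) + δ (nullable f)) + (sum (residual e) (initial e) + sum (residual f) (initial f))
      ≈⟨ ∙-cong (δ-∨ (nullable e) (nullable f))
                (symₑ (∙-cong (sum-map (residual (e + f)) inj₁ (initial e))
                              (sum-map (residual (e + f)) inj₂ (initial f)))) ⟩
    δ (nullable (e + f)) + (sum (residual (e + f)) (moveˡ (initial e)) + sum (residual (e + f)) (moveʳ (initial f)))
      ≈⟨ +-congˡ (sum-++ (residual (e + f)) (moveˡ (initial e)) (moveʳ (initial f))) ⟨
    δ (nullable (e + f)) + sum (residual (e + f)) (initial (e + f)) ∎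
    where
    δ-∨ : ∀ b c → δ b + δ c ≈ δ (b ∨ c)
    δ-∨ true  true  = mil +-idem
    δ-∨ true  false = identityʳ 𝟏
    δ-∨ false c     = identityˡ (δ c)
  expand-initial (e · f) =
    expand-▸ (residual (e · f)) (initial e) (initial f) (nullable e) (nullable f)
      (expand-· (residual e) (initial e) (expand-initial e)) (expand-initial f)
  expand-initial (e *) =
    transₑ (expand-* (residual e) (initial e) (expand-initial e))
           (+-congˡ (symₑ (sum-map (residual (e *)) inj₁ (initial e))))

  expand-residual : ∀ e p → residual e p ≈ δ (final? e p) + sum (residual e) (moves e p)
  expand-residual (act a) _        = symₑ (identityʳ 𝟏)
  expand-residual (e + f) (inj₁ p) =
    transₑ (expand-residual e p) (+-congˡ (symₑ (sum-map (residual (e + f)) inj₁ (moves e p))))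
  expand-residual (e + f) (inj₂ q) =
    transₑ (expand-residual f q) (+-congˡ (symₑ (sum-map (residual (e + f)) inj₂ (moves f q))))
  expand-residual (e · f) (inj₁ p) =
    expand-▸ (residual (e · f)) (moves e p) (initial f) (final? e p) (nullable f)
      (expand-· (residual e) (moves e p) (expand-residual e p)) (expand-initial f)
  expand-residual (e · f) (inj₂ q) =
    transₑ (expand-residual f q) (+-congˡ (symₑ (sum-map (residual (e · f)) inj₂ (moves f q))))
  expand-residual (e *)   (inj₁ p) =
    expand-return (residual (e *)) (moves e p) (final? e p) (expand-· (residual e) (moves e p) (expand-residual e p))
  expand-residual (e *)   (inj₂ _) = expand-initial (e *)

  -- For `x` equal to `f * · g` this is `residual (f * · g)` up to associativity. With `x` abstract,
  -- one lemma covers both sides of the conclusion of `rsp*`.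
  solution : ∀ (f g x : StExp A) → Pos (f * · g) → StExp A
  solution f g x (inj₁ (inj₁ p)) = residual f p · x
  solution f g x (inj₁ (inj₂ _)) = x
  solution f g x (inj₂ q)        = residual g q

  solution-provable : ∀ {f g x} → nullable f ≡ false → x ≈ f · x + g →
                      ProvableSolution (Mil⁻+ Γ) (chartOf (f * · g) (inj₁ (inj₂ tt))) (solution f g x)
  solution-provable {f} {g} {x} f↓̸ x≈ (inj₁ (inj₁ p)) =
    -- `final? (f *) (inj₁ p)` is `false`: no move leads from inside `f` directly to `g`, and
    -- `𝟎 · g` only supplies the shape that `expand-▸` expects.
    expand-▸ (solution f g x) (moves (f *) (inj₁ p)) (initial g) false (nullable g)
      (transₑ (expand-return (solution f g x ∘ inj₁) (moves f p) (final? f p) (expand-· (residual f) (moves f p) (expand-residual f p)))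
              (+-congʳ (symₑ (mil ·-zeroˡ))))
      (expand-initial g)
  solution-provable {f} {g} {x} f↓̸ x≈ (inj₁ (inj₂ _)) =
    -- The returning vertex is final in `f *`, so the chart may pass on to `g`; this matches the
    -- summand `g` of the equation for `x`.
    expand-▸ (solution f g x) (moveˡ (initial f)) (initial g) true (nullable g) root (expand-initial g)
    where
    root : x ≈ 𝟏 · g + sum (solution f g x ∘ inj₁) (moveˡ (initial f))
    root = begin
      x                                                             ≈⟨ x≈ ⟩
      f · x + g                                                     ≈⟨ comm _ _ ⟩
      g + f · x                                                     ≈⟨ ∙-cong (symₑ (mil ·-idˡ)) (expand-· (residual f) (initial f) (expand-initial f)) ⟩
      𝟏 · g + (δ (nullable f) · x + sum (λ p → residual f p · x) (initial f))
        -- The side condition enters here: a nullable `f` would leave `x` itself as an unguarded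
        -- summand.
        ≡⟨ cong (λ b → 𝟏 · g + (δ b · x + sum (λ p → residual f p · x) (initial f))) f↓̸ ⟩
      𝟏 · g + (𝟎 · x + sum (λ p → residual f p · x) (initial f))    ≈⟨ +-congˡ (transₑ (+-congʳ (mil ·-zeroˡ)) (identityˡ _)) ⟩
      𝟏 · g + sum (λ p → residual f p · x) (initial f)              ≈⟨ +-congˡ (sum-map (solution f g x ∘ inj₁) inj₁ (initial f)) ⟨
      𝟏 · g + sum (solution f g x ∘ inj₁) (moveˡ (initial f))       ∎
  solution-provable {f} {g} {x} f↓̸ x≈ (inj₂ q) =
    transₑ (expand-residual g q) (+-congˡ (symₑ (sum-map (solution f g x) inj₂ (moves g q))))

  *·-fixpoint : ∀ {f g} → f * · g ≈ f · (f * · g) + g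
  *·-fixpoint {f} {g} = begin
    f * · g                  ≈⟨ ·-congʳ (mil *-unfold) ⟩
    (𝟏 + f · f *) · g        ≈⟨ mil ·-distribʳ ⟩
    𝟏 · g + (f · f *) · g    ≈⟨ ∙-cong (mil ·-idˡ) (mil ·-assoc) ⟩
    g + f · (f * · g)        ≈⟨ comm _ _ ⟩
    f · (f * · g) + g        ∎

-- Translation of derivations.

RSP*⇒LCoProof₁ : {A : Set} {P E : Equation A} → RSP* P E → LCoProof₁ P E
RSP*⇒LCoProof₁ {P = P} (rsp* {e} {f} {g} ¬f↓) = record
  { proof = record
    { chart   = chartOf (f * · g) (inj₁ (inj₂ tt))
    ; guarded = chartOf-guarded (f * · g) (inj₁ (inj₂ tt))
    ; L       = λ v → solution f g e v ≐ solution f g (f * · g) v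
    -- The premise of `rsp*` is the equation added to `Mil⁻`.
    ; sol₁    = solution-provable f↓̸ (axiom (inj₂ refl))
    ; sol₂    = solution-provable f↓̸ *·-fixpoint
    ; start₁  = refl
    ; start₂  = refl }
  ; witnessed = nesting⇒LLEE (chartOf-nesting (f * · g) _) }
  where
  open Solutions ｛ P ｝
  f↓̸ : nullable f ≡ false
  f↓̸ = ¬-not (λ eq → ¬f↓ (nullable⇒↓ f (subst T (sym eq) tt)))

theorem6p4 : (A : Set) (e f : StExp A) → Mil A ⊢ e ≐ f → cMil₁ A ⊢ e ≐ f
theorem6p4 A e f = translate
  where
  -- This recursion on derivation trees is the effective transformation; the shape of the tree is
  -- kept and only instances of `RSP*` are replaced.
  translate : ∀ {E} → Mil A ⊢ E → cMil₁ A ⊢ E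
  translate (axiom a)     = axiom a
  translate reflₑ         = reflₑ
  translate (symₑ d)      = symₑ (translate d)
  translate (transₑ d d′) = transₑ (translate d) (translate d′)
  translate (context C d) = context C (translate d)
  translate (rule r d)    = rule (RSP*⇒LCoProof₁ r) (translate d)
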